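{- Let $q=\prod_i q_i$ be a (finite) product, where every $q_i$ is a prime power congruent to $1$ modulo $6$. Then there exists a CO$(q)$ (cubic orthomorphism of order $q$).
   Context: Cubic orthomorphism. Let $q\equiv1\pmod 6$ be a positive integer. A cubic orthomorphism of order $q$, CO$(q)$, is a triple $(G,f,G^+)$, where $G$ is an abelian group (written additively) of order $q$, $f$ is a permutation of $G$, and $G^+\subseteq G$ is such that $G$ is the disjoint union of $\{0\}$, $G^+$ and $-G^+$, satisfying: (1) the map $a\mapsto f(a)-a$ is a bijection of $G$; (2) $f(-a)=-f(a)$ for every $a\in G$ (in particular $f(0)=0$); (3) $f$ has cycle type $1^1 3^{(q-1)/3}$ (i.e. $0$ is the only fixed point and all other cycles have length $3$); (4) $f(G^+)=G^+$; (5) $a+f(a)+f^2(a)=0$ for every $a\in G$; (6) for every $b\in G$, the map $a\mapsto f^2(a)+f(b-a)$ is a bijection of $G$; (7) for every $b\in G$, the two sets $\{a+f(b)-f(a+b):a\in G^+\}$ and $\{f^2(a)+f(b)-f(a+b):a\in G^+\}$ form a partition of $G\setminus\{0\}$. Here $f^2(a)=f(f(a))$. -}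

module Defs where

open import Algebra.Bundles using (AbelianGroup)
open import Data.Fin.Base using (Fin)
open import Data.Nat.Base using (ℕ; _<_; _≤_; _^_; _%_)
open import Data.Nat.GeneralisedArithmetic using (fold)
open import Data.Nat.Primality using (Prime)
open import Data.Product.Base using (_×_; ∃; ∃₂)
open import Function.Bundles using (Inverse)
open import Function.Structures using (IsBijection)
open import Level using (0ℓ)
open import Relation.Binary.Definitions using (_Respects_)
open import Relation.Binary.PropositionalEquality using (_≡_)
import Relation.Binary.PropositionalEquality.Properties as ≡
open import Relation.Nullary.Negation.Core using (¬_)
open import Relation.Unary using (Pred; U; ∁; _∪_; _⊥_; _≐_)

IsPrimePower : ℕ → Set
IsPrimePower n = ∃₂ λ p k → Prime p × 1 ≤ k × n ≡ p ^ k

module _ (G : AbelianGroup 0ℓ 0ℓ) where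
  open AbelianGroup G
    renaming (_∙_ to infixl 6 _+_; ε to 0#; _⁻¹ to infix 8 -_)

  HasOrder : ℕ → Set
  HasOrder q = Inverse setoid (≡.setoid (Fin q))

  IsPermutation : (Carrier → Carrier) → Set
  IsPermutation = IsBijection _≈_ _≈_

  ⁅0⁆ : Pred Carrier 0ℓ
  ⁅0⁆ a = a ≈ 0#

  Image : (Carrier → Carrier) → Pred Carrier 0ℓ → Pred Carrier 0ℓ
  Image h P y = ∃ λ a → P a × y ≈ h a

  -- The cycle of f through a has length k.
  record CycleLength (f : Carrier → Carrier) (a : Carrier) (k : ℕ) : Set where
    field
      positive : 0 < k
      returns  : fold a f k ≈ a
      minimal  : ∀ m → 0 < m → m < k → ¬ (fold a f m ≈ a)

  record IsCubicOrthomorphism (q : ℕ) (f : Carrier → Carrier)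
                              (G⁺ : Pred Carrier 0ℓ) : Set where
    field
      q≡1[6]        : q % 6 ≡ 1
      order         : HasOrder q
      f-permutation : IsPermutation f

      -- G is a setoid, so its subsets are the predicates respecting _≈_.
      G⁺-resp : G⁺ Respects _≈_

      G-cover  : (⁅0⁆ ∪ G⁺ ∪ Image -_ G⁺) ≐ U
      0⊥G⁺     : ⁅0⁆ ⊥ G⁺
      0⊥-G⁺    : ⁅0⁆ ⊥ Image -_ G⁺
      G⁺⊥-G⁺   : G⁺ ⊥ Image -_ G⁺

      orthomorphism : IsPermutation (λ a → f a - a)
      odd           : ∀ a → f (- a) ≈ - f a

      -- Cycle type 1¹ 3^((q-1)/3).
      cycle-0  : CycleLength f 0# 1
      cycle-≉0 : ∀ a → a ≉ 0# → CycleLength f a 3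

      f[G⁺]≐G⁺ : Image f G⁺ ≐ G⁺
      sum-zero : ∀ a → a + f a + f (f a) ≈ 0#
      bijective-sum : ∀ b → IsPermutation (λ a → f (f a) + f (b - a))

      differences-disjoint : ∀ b →
        Image (λ a → a + f b - f (a + b)) G⁺ ⊥
        Image (λ a → f (f a) + f b - f (a + b)) G⁺
      differences-cover : ∀ b →
        (Image (λ a → a + f b - f (a + b)) G⁺ ∪
         Image (λ a → f (f a) + f b - f (a + b)) G⁺) ≐ ∁ ⁅0⁆

record CO (q : ℕ) : Set₁ where
  open AbelianGroup using (Carrier)
  field
    G  : AbelianGroup 0ℓ 0ℓ
    f  : Carrier G → Carrier G
    G⁺ : Pred (Carrier G) 0ℓ
    isCubicOrthomorphism : IsCubicOrthomorphism G q f G⁺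

{-# OPTIONS --safe #-}

-- An abelian group of order q prime to 6 with an endomorphism f such that
-- 1 + f + f² = 0 is a ℤ[ω]-module on which f - 1, a divisor of 3, is invertible.
-- Both families in condition (7) then no longer depend on b: they are ∓(f - 1)G⁺,
-- so any choice of one f-orbit from each pair {O, -O} serves as G⁺.
-- Such modules are closed under products, so prime powers suffice.  If p ≡ 1 (mod 6),
-- take powers of ℤ/p with f multiplication by a root of 1 + ω + ω²; if p ≡ 5 (mod 6),
-- the exponent is even and powers of (ℤ/p)[ω] do.
module Submission where

open import Defs
open import Algebra.Bundles using (AbelianGroup)
open import Algebra.Construct.DirectProduct using (abelianGroup)
import Algebra.Properties.CommutativeMonoid.Sum as Sum
import Algebra.Properties.Monoid.Mult as Mult
open import Data.Bool.Base using (if_then_else_)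
open import Data.Fin.Base using (Fin; zero; suc; toℕ; fromℕ<)
open import Data.Fin.Permutation using (Permutation′; _⟨$⟩ʳ_)
import Data.Fin.Properties as Fin
open import Data.Integer.Base as ℤ using (ℤ; +_; 0ℤ; 1ℤ; -1ℤ; _%ℕ_; _/ℕ_)
import Data.Integer.DivMod as ℤ
import Data.Integer.Properties as ℤ
open import Data.Integer.Tactic.RingSolver using (solve-∀)
open import Data.List.Base using (List; _∷_)
open import Data.List.Relation.Unary.All using (All; []; _∷_)
open import Data.Nat.Base as ℕ
  using (ℕ; zero; suc; NonZero; z≤n; s≤s; _⊓_; _%_; _/_; _^_)
open import Data.Nat.Coprimality using (prime⇒coprime; coprime-Bézout)
import Data.Nat.Divisibility as ℕ
import Data.Nat.DivMod as ℕ
open import Data.Nat.GCD using (module Bézout)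
open import Data.Nat.ListAction using (product)
open import Data.Nat.Primality using (Prime; prime⇒nonTrivial; prime⇒nonZero)
import Data.Nat.Properties as ℕ
import Data.Nat.Tactic.RingSolver as ℕ
open import Data.Product.Base using (_×_; _,_; ∃; proj₁; proj₂)
open import Data.Product.Function.NonDependent.Setoid using (_×-inverse_)
open import Data.Product.Relation.Binary.Pointwise.NonDependent using (Pointwise-≡↔≡)
open import Data.Sum.Base using (_⊎_; inj₁; inj₂)
open import Data.Unit.Base using (tt)
open import Function.Bundles using (Inverse)
open import Function.Construct.Composition using (inverse)
import Function.Construct.Symmetry as Symmetry
open import Level using (0ℓ)
open import Relation.Binary.Definitions using (tri<; tri≈; tri>)
open import Relation.Binary.PropositionalEquality as ≡ using (_≡_; _≢_)
import Relation.Binary.Reasoning.Setoid as ≈-Reasoning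
open import Relation.Binary.Structures using (IsEquivalence)
open import Relation.Nullary.Decidable
  using (does; yes; no; dec-true; dec-false; toWitness; _→-dec_; _⊎-dec_; _×-dec_)
open import Relation.Nullary.Negation.Core using (¬_; contradiction)
open import Relation.Unary using (Pred)

-- Arithmetic enters through q = 1 + 6m annihilating G: multiplication by 2 and by 3 is then
-- injective, and 3 has the explicit inverse -2m. The root ω for p ≡ 1 (mod 6) comes from a count
-- instead of a generator of the multiplicative group. On the projective line over ℤ/p, the map x ↦
-- -1/(1+x) has order 3. Its p + 1 ≡ 2 (mod 3) points cannot all lie in 3-cycles, so some point is
-- fixed, and the fixed-point equation is 1 + x + x² = 0. On ℤ/p alone, the cycle 0, -1, ∞ shrinks
-- to a transposition of 0 and -1, and the count has to compensate for the missing ∞. Such a count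
-- only refutes the absence of a root; a finite search then yields one. The choice of orbits is
-- effective too: it compares least indices under the numbering given by `order`.

multiple : (G : AbelianGroup 0ℓ 0ℓ) → ℕ → AbelianGroup.Carrier G → AbelianGroup.Carrier G
multiple G = Mult._×_ (AbelianGroup.monoid G)

-- Carrying `torsion` as data takes the place of Lagrange's theorem: it is immediate for ℤ/n and
-- passes to products.
record EisensteinGroup (q : ℕ) : Set₁ where
  field
    G : AbelianGroup 0ℓ 0ℓ
  open AbelianGroup G public
    renaming (_∙_ to infixl 6 _+_; ε to 0#; _⁻¹ to infix 8 -_
             ; ∙-cong to +-cong; ∙-congˡ to +-congˡ; ∙-congʳ to +-congʳ
             ; ⁻¹-cong to -‿cong)
  field
    f        : Carrier → Carrier
    f-cong   : ∀ {a b} → a ≈ b → f a ≈ f b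
    f-homo   : ∀ a b → f (a + b) ≈ f a + f b
    sum-zero : ∀ a → a + f a + f (f a) ≈ 0#
    order    : HasOrder G q
    torsion  : ∀ a → multiple G q a ≈ 0#

-- From an endomorphism with 1 + f + f² = 0 to a cubic orthomorphism

module _ {q : ℕ} (E : EisensteinGroup q) (q≡1[6] : q % 6 ≡ 1) where
  open EisensteinGroup E
  open import Algebra.Properties.AbelianGroup G
  open import Algebra.Properties.CommutativeSemigroup
    (AbelianGroup.commutativeSemigroup G) using (interchange)
  open ≈-Reasoning setoid

  private
    infixr 7 _·_
    _·_ : ℕ → Carrier → Carrier
    _·_ = multiple G
    open Mult monoid using (×-assocˡ; ×-congʳ)

  q≡1+m*6 : q ≡ suc (q / 6 ℕ.* 6)
  q≡1+m*6 = ≡.trans (ℕ.m≡m%n+[m/n]*n q 6) (≡.cong (ℕ._+ q / 6 ℕ.* 6) q≡1[6])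

  -- With m = `q / 6`, q · a = a + (m d) · (e · a). If e kills a, this leaves a itself, while q
  -- kills every element.
  torsion-free : ∀ d e → d ℕ.* e ≡ 6 → ∀ a → e · a ≈ 0# → a ≈ 0#
  torsion-free d e de≡6 a ea≈0 = begin
    a                             ≈⟨ identityʳ a ⟨
    a + 0#                        ≈⟨ +-congˡ (multiple-0 (q / 6 ℕ.* d)) ⟨
    a + (q / 6 ℕ.* d) · 0#        ≈⟨ +-congˡ (×-congʳ (q / 6 ℕ.* d) ea≈0) ⟨
    a + (q / 6 ℕ.* d) · e · a     ≈⟨ +-congˡ (×-assocˡ a (q / 6 ℕ.* d) e) ⟩
    a + (q / 6 ℕ.* d ℕ.* e) · a   ≡⟨ ≡.cong (λ k → a + k · a) (ℕ.*-assoc (q / 6) d e) ⟩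
    a + (q / 6 ℕ.* (d ℕ.* e)) · a ≡⟨ ≡.cong (λ k → a + (q / 6 ℕ.* k) · a) de≡6 ⟩
    suc (q / 6 ℕ.* 6) · a         ≡⟨ ≡.cong (_· a) q≡1+m*6 ⟨
    q · a                         ≈⟨ torsion a ⟩
    0#                            ∎
    where
    multiple-0 : ∀ k → k · 0# ≈ 0#
    multiple-0 zero    = refl
    multiple-0 (suc k) = trans (identityˡ _) (multiple-0 k)

  3a≈0⇒a≈0 : ∀ a → a + a + a ≈ 0# → a ≈ 0#
  3a≈0⇒a≈0 a eq = torsion-free 2 3 ≡.refl a (begin
    a + (a + (a + 0#)) ≈⟨ +-congˡ (+-congˡ (identityʳ a)) ⟩
    a + (a + a)        ≈⟨ assoc a a a ⟨
    a + a + a          ≈⟨ eq ⟩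
    0#                 ∎)

  a≈-a⇒a≈0 : ∀ a → a ≈ - a → a ≈ 0#
  a≈-a⇒a≈0 a eq = torsion-free 3 2 ≡.refl a (begin
    a + (a + 0#) ≈⟨ +-congˡ (identityʳ a) ⟩
    a + a        ≈⟨ +-congˡ eq ⟩
    a - a        ≈⟨ inverseʳ a ⟩
    0#           ∎)

  third : ∀ y → ∃ λ c → c + c + c ≈ y
  third y = c , (begin
    c + c + c                     ≈⟨ assoc c c c ⟩
    c + (c + c)                   ≈⟨ +-congˡ (+-congˡ (identityʳ c)) ⟨
    3 · c                         ≈⟨ ×-assocˡ (- y) 3 (q / 6 ℕ.* 2) ⟩
    (3 ℕ.* (q / 6 ℕ.* 2)) · (- y) ≡⟨ ≡.cong (_· (- y)) 3*m*2≡m*6 ⟩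
    (q / 6 ℕ.* 6) · (- y)         ≈⟨ inverseʳ-unique (- y) _ -y+6m·-y≈0 ⟩
    - - y                         ≈⟨ ⁻¹-involutive y ⟩
    y                             ∎)
    where
    -- From 1 = q - 6m with m = `q / 6`, the inverse of 3 modulo q is -2m.
    c = (q / 6 ℕ.* 2) · (- y)
    3*m*2≡m*6 : 3 ℕ.* (q / 6 ℕ.* 2) ≡ q / 6 ℕ.* 6
    3*m*2≡m*6 = ≡.trans (ℕ.*-comm 3 (q / 6 ℕ.* 2)) (ℕ.*-assoc (q / 6) 2 3)
    -y+6m·-y≈0 : suc (q / 6 ℕ.* 6) · (- y) ≈ 0#
    -y+6m·-y≈0 = trans (reflexive (≡.cong (_· (- y)) (≡.sym q≡1+m*6))) (torsion (- y))

  f-0 : f 0# ≈ 0#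
  f-0 = identityˡ-unique (f 0#) (f 0#)
    (trans (sym (f-homo 0# 0#)) (f-cong (identityˡ 0#)))

  f-neg : ∀ a → f (- a) ≈ - f a
  f-neg a = inverseˡ-unique (f (- a)) (f a)
    (trans (sym (f-homo (- a) a)) (trans (f-cong (inverseˡ a)) f-0))

  a≈-[fa+ffa] : ∀ a → a ≈ - (f a + f (f a))
  a≈-[fa+ffa] a = inverseˡ-unique _ _ (trans (sym (assoc _ _ _)) (sum-zero a))

  f³≈id : ∀ a → f (f (f a)) ≈ a
  f³≈id a = begin
    f (f (f a))       ≈⟨ inverseʳ-unique _ _ (sum-zero (f a)) ⟩
    - (f a + f (f a)) ≈⟨ a≈-[fa+ffa] a ⟨
    a                 ∎

  f-injective : ∀ {a b} → f a ≈ f b → a ≈ b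
  f-injective {a} {b} eq = trans (sym (f³≈id a)) (trans (f-cong (f-cong eq)) (f³≈id b))

  sub-+ : ∀ a b c d → (a + b) - (c + d) ≈ (a - c) + (b - d)
  sub-+ a b c d = trans (+-congˡ (sym (⁻¹-∙-comm c d))) (interchange a b (- c) (- d))

  Δ : Carrier → Carrier
  Δ a = f a - a

  Δ-cong : ∀ {a b} → a ≈ b → Δ a ≈ Δ b
  Δ-cong eq = +-cong (f-cong eq) (-‿cong eq)

  Δ-neg : ∀ a → Δ (- a) ≈ - Δ a
  Δ-neg a = trans (+-congʳ (f-neg a)) (⁻¹-∙-comm (f a) (- a))

  Δ-homo : ∀ a b → Δ (a + b) ≈ Δ a + Δ b
  Δ-homo a b = trans (+-congʳ (f-homo a b)) (sub-+ (f a) (f b) a b)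

  fa≈a⇒a≈0 : ∀ a → f a ≈ a → a ≈ 0#
  fa≈a⇒a≈0 a fa≈a = 3a≈0⇒a≈0 a (begin
    a + a + a         ≈⟨ +-cong (+-congˡ fa≈a) (trans (f-cong fa≈a) fa≈a) ⟨
    a + f a + f (f a) ≈⟨ sum-zero a ⟩
    0#                ∎)

  Δ-injective : ∀ {a b} → Δ a ≈ Δ b → a ≈ b
  Δ-injective {a} {b} eq = x∙y⁻¹≈ε⇒x≈y a b (fa≈a⇒a≈0 (a - b) (x∙y⁻¹≈ε⇒x≈y _ _ (begin
    Δ (a - b)     ≈⟨ Δ-homo a (- b) ⟩
    Δ a + Δ (- b) ≈⟨ +-congˡ (Δ-neg b) ⟩
    Δ a - Δ b     ≈⟨ x≈y⇒x∙y⁻¹≈ε eq ⟩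
    0#            ∎)))

  -- In ℤ[ω], (ω - 1)(ω² - 1) = 3.
  Δ-surjective : ∀ y → ∃ λ a → Δ a ≈ y
  Δ-surjective y with third y
  ... | c , 3c≈y = f (f c) - c , (begin
    f (f (f c) - c) - (f (f c) - c)         ≈⟨ +-cong (f-homo _ _) (⁻¹-anti-homo‿- (f (f c)) c) ⟩
    (f (f (f c)) + f (- c)) + (c - f (f c)) ≈⟨ +-congʳ (+-cong (f³≈id c) (f-neg c)) ⟩
    (c - f c) + (c - f (f c))               ≈⟨ sub-+ c c (f c) (f (f c)) ⟨
    (c + c) - (f c + f (f c))               ≈⟨ +-congˡ (a≈-[fa+ffa] c) ⟨
    c + c + c                               ≈⟨ 3c≈y ⟩
    y                                       ∎)

  difference₁ : ∀ a b → a + f b - f (a + b) ≈ - Δ a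
  difference₁ a b = begin
    a + f b - f (a + b)       ≈⟨ +-congˡ (-‿cong (f-homo a b)) ⟩
    a + f b - (f a + f b)     ≈⟨ sub-+ a (f b) (f a) (f b) ⟩
    (a - f a) + (f b - f b)   ≈⟨ +-congˡ (inverseʳ (f b)) ⟩
    (a - f a) + 0#            ≈⟨ identityʳ _ ⟩
    a - f a                   ≈⟨ ⁻¹-anti-homo‿- (f a) a ⟨
    - Δ a                     ∎

  difference₂ : ∀ a b → f (f a) + f b - f (a + b) ≈ Δ (f a)
  difference₂ a b = begin
    f (f a) + f b - f (a + b)     ≈⟨ +-congˡ (-‿cong (f-homo a b)) ⟩
    f (f a) + f b - (f a + f b)   ≈⟨ sub-+ (f (f a)) (f b) (f a) (f b) ⟩
    Δ (f a) + (f b - f b)         ≈⟨ +-congˡ (inverseʳ (f b)) ⟩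
    Δ (f a) + 0#                  ≈⟨ identityʳ _ ⟩
    Δ (f a)                       ∎

  -- Reduces condition (6) to the bijectivity of `Δ`: what remains is `Δ` after f, followed by a
  -- translation.
  sum≈Δ : ∀ b a → f (f a) + f (b - a) ≈ Δ (f a) + f b
  sum≈Δ b a = begin
    f (f a) + f (b - a)     ≈⟨ +-congˡ (trans (f-homo b (- a)) (+-congˡ (f-neg a))) ⟩
    f (f a) + (f b - f a)   ≈⟨ +-congˡ (comm (f b) (- f a)) ⟩
    f (f a) + (- f a + f b) ≈⟨ assoc _ _ _ ⟨
    Δ (f a) + f b           ∎

  permutation : ∀ {h} → (∀ {a b} → a ≈ b → h a ≈ h b) → (∀ {a b} → h a ≈ h b → a ≈ b) →
                (∀ y → ∃ λ a → h a ≈ y) → IsPermutation G h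
  permutation cong injective surjective = record
    { isInjection = record
      { isCongruent = record
        { cong = cong ; isEquivalence₁ = isEquivalence ; isEquivalence₂ = isEquivalence }
      ; injective = injective }
    ; surjective = λ y → let a , ha≈y = surjective y in a , λ z≈a → trans (cong z≈a) ha≈y
    }

  sum-permutation : ∀ b → IsPermutation G (λ a → f (f a) + f (b - a))
  sum-permutation b = permutation
    (λ a≈a′ → +-cong (f-cong (f-cong a≈a′)) (f-cong (+-congˡ (-‿cong a≈a′))))
    (λ {a} {a′} eq → f-injective (Δ-injective (∙-cancelʳ (f b) _ _
      (trans (sym (sum≈Δ b a)) (trans eq (sum≈Δ b a′))))))
    surjective
    where
    surjective : ∀ y → ∃ λ a → f (f a) + f (b - a) ≈ y
    surjective y with Δ-surjective (y - f b)
    ... | a , Δa≈y-fb = f (f a) , (begin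
      f (f (f (f a))) + f (b - f (f a)) ≈⟨ sum≈Δ b (f (f a)) ⟩
      Δ (f (f (f a))) + f b             ≈⟨ +-congʳ (trans (Δ-cong (f³≈id a)) Δa≈y-fb) ⟩
      y - f b + f b                     ≈⟨ //-rightDividesˡ (f b) y ⟩
      y                                 ∎)

  -- Choosing one f-orbit from each pair of opposite orbits

  index : Carrier → ℕ
  index a = toℕ (Inverse.to order a)

  index-cong : ∀ {a b} → a ≈ b → index a ≡ index b
  index-cong eq = ≡.cong toℕ (Inverse.to-cong order eq)

  index-injective : ∀ {a b} → index a ≡ index b → a ≈ b
  index-injective {a} {b} eq = begin
    a                                         ≈⟨ Inverse.strictlyInverseʳ order a ⟨
    Inverse.from order (Inverse.to order a)   ≡⟨ ≡.cong (Inverse.from order) (Fin.toℕ-injective eq) ⟩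
    Inverse.from order (Inverse.to order b)   ≈⟨ Inverse.strictlyInverseʳ order b ⟩
    b                                         ∎

  -- A numerical label of the f-orbit of a. As `index` is injective, distinct orbits have distinct
  -- labels, so choosing between two orbits becomes a decidable comparison in ℕ.
  orbitMin : Carrier → ℕ
  orbitMin a = index a ⊓ (index (f a) ⊓ index (f (f a)))

  orbitMin-cong : ∀ {a b} → a ≈ b → orbitMin a ≡ orbitMin b
  orbitMin-cong eq = ≡.cong₂ _⊓_ (index-cong eq)
    (≡.cong₂ _⊓_ (index-cong (f-cong eq)) (index-cong (f-cong (f-cong eq))))

  orbitMin-f : ∀ a → orbitMin (f a) ≡ orbitMin a
  orbitMin-f a rewrite index-cong (f³≈id a) =
    ≡.trans (≡.sym (ℕ.⊓-assoc (index (f a)) _ _)) (ℕ.⊓-comm _ (index a))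

  orbitMin-attained : ∀ a →
    orbitMin a ≡ index a ⊎ orbitMin a ≡ index (f a) ⊎ orbitMin a ≡ index (f (f a))
  orbitMin-attained a with ℕ.⊓-sel (index a) (index (f a) ⊓ index (f (f a)))
  ... | inj₁ eq = inj₁ eq
  ... | inj₂ eq with ℕ.⊓-sel (index (f a)) (index (f (f a)))
  ...   | inj₁ eq′ = inj₂ (inj₁ (≡.trans eq eq′))
  ...   | inj₂ eq′ = inj₂ (inj₂ (≡.trans eq eq′))

  f-reflects-0 : ∀ {a} → f a ≈ 0# → a ≈ 0#
  f-reflects-0 fa≈0 = f-injective (trans fa≈0 (sym f-0))

  -- By injectivity of `index`, equal minima force a to be -a, -f a or -f² a. The first gives 2a =
  -- 0. The others are excluded for a nonzero because 1 + f = -f² and 1 + f² = -f are injective.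
  minimal⇒≈0 : ∀ a → orbitMin a ≡ index a → orbitMin a ≡ orbitMin (- a) → a ≈ 0#
  minimal⇒≈0 a min≡a min≡ with orbitMin-attained (- a)
  ... | inj₁ eq = a≈-a⇒a≈0 a (index-injective (≡.trans (≡.sym min≡a) (≡.trans min≡ eq)))
  ... | inj₂ (inj₁ eq) = f-reflects-0 (f-reflects-0 (begin
    f (f a)           ≈⟨ identityˡ _ ⟨
    0# + f (f a)      ≈⟨ +-congʳ (trans (+-congʳ a≈-fa) (inverseˡ (f a))) ⟨
    a + f a + f (f a) ≈⟨ sum-zero a ⟩
    0#                ∎))
    where
    a≈-fa : a ≈ - f a
    a≈-fa = trans (index-injective (≡.trans (≡.sym min≡a) (≡.trans min≡ eq))) (f-neg a)
  ... | inj₂ (inj₂ eq) = f-reflects-0 (begin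
    f a                 ≈⟨ identityˡ _ ⟨
    0# + f a            ≈⟨ +-congʳ (trans (+-congʳ a≈-ffa) (inverseˡ _)) ⟨
    a + f (f a) + f a   ≈⟨ assoc _ _ _ ⟩
    a + (f (f a) + f a) ≈⟨ +-congˡ (comm _ _) ⟩
    a + (f a + f (f a)) ≈⟨ assoc _ _ _ ⟨
    a + f a + f (f a)   ≈⟨ sum-zero a ⟩
    0#                  ∎)
    where
    a≈-ffa : a ≈ - f (f a)
    a≈-ffa = trans (index-injective (≡.trans (≡.sym min≡a) (≡.trans min≡ eq)))
      (trans (f-cong (f-neg a)) (f-neg (f a)))

  orbitMin-neg-f : ∀ a → orbitMin a ≡ orbitMin (- a) → orbitMin (f a) ≡ orbitMin (- f a)
  orbitMin-neg-f a min≡ = ≡.trans (orbitMin-f a) (≡.trans min≡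
    (≡.trans (≡.sym (orbitMin-f (- a))) (orbitMin-cong (f-neg a))))

  -- The hypothesis is constant along the orbit, so a may be moved to the member of least index,
  -- where `minimal⇒≈0` applies; f reflects zero, which brings the conclusion back to a.
  orbitMin-neg⇒≈0 : ∀ a → orbitMin a ≡ orbitMin (- a) → a ≈ 0#
  orbitMin-neg⇒≈0 a min≡ with orbitMin-attained a
  ... | inj₁ eq = minimal⇒≈0 a eq min≡
  ... | inj₂ (inj₁ eq) = f-reflects-0 (minimal⇒≈0 (f a)
    (≡.trans (orbitMin-f a) eq) (orbitMin-neg-f a min≡))
  ... | inj₂ (inj₂ eq) = f-reflects-0 (f-reflects-0 (minimal⇒≈0 (f (f a))
    (≡.trans (orbitMin-f (f a)) (≡.trans (orbitMin-f a) eq))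
    (orbitMin-neg-f (f a) (orbitMin-neg-f a min≡))))

  -- ⟨-f⟩ acts freely on G ∖ {0}; each of its orbits {±a, ±f a, ±f² a}
  -- contributes to G⁺ the f-orbit that contains its element of least index.
  G⁺ : Pred Carrier 0ℓ
  G⁺ a = orbitMin a ℕ.< orbitMin (- a)

  G⁺-resp : ∀ {a b} → a ≈ b → G⁺ a → G⁺ b
  G⁺-resp eq = ≡.subst₂ ℕ._<_ (orbitMin-cong eq) (orbitMin-cong (-‿cong eq))

  G⁺-f : ∀ {a} → G⁺ a → G⁺ (f a)
  G⁺-f {a} = ≡.subst₂ ℕ._<_ (≡.sym (orbitMin-f a))
    (≡.trans (≡.sym (orbitMin-f (- a))) (orbitMin-cong (f-neg a)))

  0∉G⁺ : ∀ {a} → a ≈ 0# → ¬ G⁺ a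
  0∉G⁺ a≈0 = ℕ.<-irrefl (orbitMin-cong (trans a≈0 (sym (trans (-‿cong a≈0) ε⁻¹≈ε))))

  G⁺⇒-∉G⁺ : ∀ {a} → G⁺ a → ¬ G⁺ (- a)
  G⁺⇒-∉G⁺ {a} a∈ -a∈ = ℕ.<-asym a∈
    (≡.subst (orbitMin (- a) ℕ.<_) (orbitMin-cong (⁻¹-involutive a)) -a∈)

  trichotomy : ∀ a → a ≈ 0# ⊎ G⁺ a ⊎ Image G -_ G⁺ a
  trichotomy a with ℕ.<-cmp (orbitMin a) (orbitMin (- a))
  ... | tri< a∈ _ _  = inj₂ (inj₁ a∈)
  ... | tri≈ _ eq _  = inj₁ (orbitMin-neg⇒≈0 a eq)
  ... | tri> _ _ -a∈ = inj₂ (inj₂ (- a ,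
    ≡.subst (orbitMin (- a) ℕ.<_) (orbitMin-cong (sym (⁻¹-involutive a))) -a∈ ,
    sym (⁻¹-involutive a)))

  -- Verification of the conditions

  Δa≉0 : ∀ {a} → G⁺ a → ¬ (Δ a ≈ 0#)
  Δa≉0 {a} a∈ Δa≈0 = 0∉G⁺ (fa≈a⇒a≈0 a (x∙y⁻¹≈ε⇒x≈y _ _ Δa≈0)) a∈

  cubicOrthomorphism : CO q
  cubicOrthomorphism = record { G = G ; f = f ; G⁺ = G⁺ ; isCubicOrthomorphism = record
    { q≡1[6] = q≡1[6]
    ; order = order
    ; f-permutation = permutation f-cong f-injective (λ y → f (f y) , f³≈id y)
    ; G⁺-resp = G⁺-resp
    ; G-cover = (λ _ → tt) , λ {a} _ → trichotomy a
    ; 0⊥G⁺ = λ (a≈0 , a∈) → 0∉G⁺ a≈0 a∈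
    ; 0⊥-G⁺ = λ (a≈0 , b , b∈ , a≈-b) →
        0∉G⁺ (⁻¹-injective (trans (sym a≈-b) (trans a≈0 (sym ε⁻¹≈ε)))) b∈
    ; G⁺⊥-G⁺ = λ (a∈ , b , b∈ , a≈-b) → G⁺⇒-∉G⁺ b∈ (G⁺-resp a≈-b a∈)
    ; orthomorphism = permutation Δ-cong Δ-injective Δ-surjective
    ; odd = f-neg
    ; cycle-0 = record
      { positive = s≤s z≤n ; returns = f-0 ; minimal = λ { (suc _) _ (s≤s ()) } }
    ; cycle-≉0 = λ a a≉0 → record
      { positive = s≤s z≤n
      ; returns = f³≈id a
      ; minimal = λ where
          1 _ _ fa≈a  → a≉0 (fa≈a⇒a≈0 a fa≈a)
          2 _ _ ffa≈a → a≉0 (fa≈a⇒a≈0 a (trans (f-cong (sym ffa≈a)) (f³≈id a)))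
          (suc (suc (suc _))) _ (s≤s (s≤s (s≤s ())))
      }
    ; f[G⁺]≐G⁺ =
        (λ (a , a∈ , y≈fa) → G⁺-resp (sym y≈fa) (G⁺-f a∈)) ,
        λ {y} y∈ → f (f y) , G⁺-f (G⁺-f y∈) , sym (f³≈id y)
    ; sum-zero = sum-zero
    ; bijective-sum = sum-permutation
    ; differences-disjoint = λ b ((a , a∈ , y≈) , (a′ , a′∈ , y≈′)) →
        -- A common value of the two families gives Δ (f a′) = Δ (- a), hence f a′ = - a. But f a′
        -- lies in `G⁺` and - a does not.
        G⁺⇒-∉G⁺ a∈ (G⁺-resp
          (Δ-injective (begin
            Δ (f a′)                       ≈⟨ difference₂ a′ b ⟨
            f (f a′) + f b - f (a′ + b)    ≈⟨ y≈′ ⟨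
            _                              ≈⟨ y≈ ⟩
            a + f b - f (a + b)            ≈⟨ difference₁ a b ⟩
            - Δ a                          ≈⟨ Δ-neg a ⟨
            Δ (- a)                        ∎))
          (G⁺-f a′∈))
    ; differences-cover = λ b → differences≉0 b , λ {y} y≉0 → differences-exhaust b y y≉0
    } }
    where
    differences≉0 : ∀ b {y} →
      Image G (λ a → a + f b - f (a + b)) G⁺ y ⊎
      Image G (λ a → f (f a) + f b - f (a + b)) G⁺ y → ¬ (y ≈ 0#)
    differences≉0 b (inj₁ (a , a∈ , y≈)) y≈0 = Δa≉0 a∈ (⁻¹-injective
      (trans (sym (difference₁ a b)) (trans (sym y≈) (trans y≈0 (sym ε⁻¹≈ε)))))
    differences≉0 b (inj₂ (a , a∈ , y≈)) y≈0 = Δa≉0 (G⁺-f a∈)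
      (trans (sym (difference₂ a b)) (trans (sym y≈) y≈0))

    differences-exhaust : ∀ b y → ¬ (y ≈ 0#) →
      Image G (λ a → a + f b - f (a + b)) G⁺ y ⊎
      Image G (λ a → f (f a) + f b - f (a + b)) G⁺ y
    differences-exhaust b y y≉0 with Δ-surjective y
    ... | a , Δa≈y with trichotomy a
    ...   | inj₁ a≈0 = contradiction (trans (sym Δa≈y)
              (trans (+-congʳ (trans (f-cong a≈0) (trans f-0 (sym a≈0)))) (inverseʳ a))) y≉0
    -- The second family is a ↦ Δ (f a), so the preimage of a under f is wanted, and that is f² a.
    ...   | inj₂ (inj₁ a∈) = inj₂ (f (f a) , G⁺-f (G⁺-f a∈) , (begin
              y               ≈⟨ Δa≈y ⟨
              Δ a             ≈⟨ Δ-cong (f³≈id a) ⟨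
              Δ (f (f (f a))) ≈⟨ difference₂ (f (f a)) b ⟨
              _               ∎))
    ...   | inj₂ (inj₂ (c , c∈ , a≈-c)) = inj₁ (c , c∈ , (begin
              y       ≈⟨ Δa≈y ⟨
              Δ a     ≈⟨ Δ-cong a≈-c ⟩
              Δ (- c) ≈⟨ Δ-neg c ⟩
              - Δ c   ≈⟨ difference₁ c b ⟨
              _       ∎))

-- The integers modulo n

module Modular (n : ℕ) where
  open import Data.Integer.Base using (_+_; _*_; -_; _-_)
  infix 4 _≈_
  -- Congruence is imposed on ℤ without reducing representatives, so that ring identities hold as
  -- plain equalities of integers.
  record _≈_ (a b : ℤ) : Set where
    constructor congruent
    field
      quotient : ℤ
      equality : a ≡ b + quotient * + n

  ≈-reflexive : ∀ {a b} → a ≡ b → a ≈ b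
  ≈-reflexive {a} ≡.refl = congruent 0ℤ ((lemma a (+ n)))
    where lemma : ∀ a n → a ≡ a + 0ℤ * n
          lemma = solve-∀

  ≈-sym : ∀ {a b} → a ≈ b → b ≈ a
  ≈-sym {b = b} (congruent k ≡.refl) = congruent (- k) (lemma b k (+ n))
    where lemma : ∀ b k n → b ≡ b + k * n + - k * n
          lemma = solve-∀

  ≈-trans : ∀ {a b c} → a ≈ b → b ≈ c → a ≈ c
  ≈-trans {c = c} (congruent k ≡.refl) (congruent l ≡.refl) = congruent (l + k) (lemma c k l (+ n))
    where lemma : ∀ c k l n → c + l * n + k * n ≡ c + (l + k) * n
          lemma = solve-∀

  +-cong : ∀ {a b c d} → a ≈ b → c ≈ d → a + c ≈ b + d
  +-cong {b = b} {d = d} (congruent k ≡.refl) (congruent l ≡.refl) =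
    congruent (k + l) (lemma b d k l (+ n))
    where lemma : ∀ b d k l n → b + k * n + (d + l * n) ≡ b + d + (k + l) * n
          lemma = solve-∀

  *-cong : ∀ {a b c d} → a ≈ b → c ≈ d → a * c ≈ b * d
  *-cong {b = b} {d = d} (congruent k ≡.refl) (congruent l ≡.refl) =
    congruent (k * d + b * l + k * l * + n) (lemma b d k l (+ n))
    where lemma : ∀ b d k l n → (b + k * n) * (d + l * n) ≡ b * d + (k * d + b * l + k * l * n) * n
          lemma = solve-∀

  -‿cong : ∀ {a b} → a ≈ b → - a ≈ - b
  -‿cong {b = b} (congruent k ≡.refl) = congruent (- k) (lemma b k (+ n))
    where lemma : ∀ b k n → - (b + k * n) ≡ - b + - k * n
          lemma = solve-∀

  ≈-isEquivalence : IsEquivalence _≈_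
  ≈-isEquivalence = record { refl = ≈-reflexive ≡.refl ; sym = ≈-sym ; trans = ≈-trans }

  ℤ/ : AbelianGroup 0ℓ 0ℓ
  ℤ/ = record
    { _≈_ = _≈_ ; _∙_ = _+_ ; ε = 0ℤ ; _⁻¹ = -_
    ; isAbelianGroup = record
      { isGroup = record
        { isMonoid = record
          { isSemigroup = record
            { isMagma = record { isEquivalence = ≈-isEquivalence ; ∙-cong = +-cong }
            ; assoc = λ a b c → ≈-reflexive (ℤ.+-assoc a b c) }
          ; identity = (λ a → ≈-reflexive (ℤ.+-identityˡ a)) , (λ a → ≈-reflexive (ℤ.+-identityʳ a)) }
        ; inverse = (λ a → ≈-reflexive (ℤ.+-inverseˡ a)) , (λ a → ≈-reflexive (ℤ.+-inverseʳ a))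
        ; ⁻¹-cong = -‿cong }
      ; comm = λ a b → ≈-reflexive (ℤ.+-comm a b) } }

  open AbelianGroup ℤ/ public using (setoid)

  n≈0 : + n ≈ 0ℤ
  n≈0 = congruent 1ℤ (lemma (+ n))
    where lemma : ∀ n → n ≡ 0ℤ + 1ℤ * n
          lemma = solve-∀

  multiple≡* : ∀ k a → multiple ℤ/ k a ≡ + k * a
  multiple≡* zero    a = ≡.refl
  multiple≡* (suc k) a = ≡.trans (≡.cong (λ b → a + b) (multiple≡* k a)) (lemma (+ k) a)
    where lemma : ∀ k a → a + k * a ≡ (1ℤ + k) * a
          lemma = solve-∀

  ℤ/-torsion : ∀ a → multiple ℤ/ n a ≈ 0ℤ
  ℤ/-torsion a = ≈-trans (≈-reflexive (multiple≡* n a)) (*-cong n≈0 (≈-reflexive ≡.refl))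

  -- n divides |r - s|, which is at most max(r, s) and hence below n; only 0 qualifies.
  residue-unique : ∀ {r s} → r ℕ.< n → s ℕ.< n → + r ≈ + s → r ≡ s
  residue-unique {r} {s} r<n s<n (congruent k r≡s+kn)
    with ℤ.∣ r ℤ.⊖ s ∣ in eq
  ... | zero  = ℤ.+-injective
    (ℤ.i-j≡0⇒i≡j (+ r) (+ s) (≡.trans (ℤ.m-n≡m⊖n r s) (ℤ.∣i∣≡0⇒i≡0 eq)))
  ... | suc d = contradiction n∣ (ℕ.>⇒∤ d<n)
    where
    d<n : suc d ℕ.< n
    d<n = ≡.subst (ℕ._< n) eq (ℕ.≤-<-trans (ℤ.∣m⊝n∣≤m⊔n r s) (ℕ.⊔-lub r<n s<n))
    lemma : ∀ s k n → s + k * n - s ≡ k * n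
    lemma = solve-∀
    n∣ : n ℕ.∣ suc d
    n∣ = ℕ.divides ℤ.∣ k ∣ (begin
      suc d           ≡⟨ eq ⟨
      ℤ.∣ r ℤ.⊖ s ∣   ≡⟨ ≡.cong ℤ.∣_∣ (ℤ.m-n≡m⊖n r s) ⟨
      ℤ.∣ + r - + s ∣ ≡⟨ ≡.cong (λ i → ℤ.∣ i - + s ∣) r≡s+kn ⟩
      ℤ.∣ + s + k * + n - + s ∣ ≡⟨ ≡.cong ℤ.∣_∣ (lemma (+ s) k (+ n)) ⟩
      ℤ.∣ k * + n ∣   ≡⟨ ℤ.abs-* k (+ n) ⟩
      ℤ.∣ k ∣ ℕ.* n   ∎)
      where open ≡.≡-Reasoning

  module _ .{{_ : NonZero n}} where

    ≈-% : ∀ a → a ≈ + (a %ℕ n)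
    ≈-% a = congruent (a /ℕ n) (ℤ.a≡a%ℕn+[a/ℕn]*n a n)

    ℤ/-order : HasOrder ℤ/ n
    ℤ/-order = record
      { to = to
      ; from = λ i → + toℕ i
      ; to-cong = to-cong
      ; from-cong = λ { ≡.refl → ≈-reflexive ≡.refl }
      ; inverse = (λ { {i} ≡a → ≡.trans (to-cong ≡a) (to-toℕ i) })
                , (λ { {a} ≡.refl → ≈-sym (toℕ-to a) })
      }
      where
      to : ℤ → Fin n
      to a = fromℕ< (ℤ.n%ℕd<d a n)
      to-cong : ∀ {a b} → a ≈ b → to a ≡ to b
      to-cong {a} {b} a≈b = Fin.fromℕ<-cong _ _
        (residue-unique (ℤ.n%ℕd<d a n) (ℤ.n%ℕd<d b n)
          (≈-trans (≈-sym (≈-% a)) (≈-trans a≈b (≈-% b)))) _ _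
      toℕ-to : ∀ a → a ≈ + toℕ (to a)
      toℕ-to a = ≈-trans (≈-% a) (≈-reflexive (≡.cong +_ (≡.sym (Fin.toℕ-fromℕ< (ℤ.n%ℕd<d a n)))))
      to-toℕ : ∀ i → to (+ toℕ i) ≡ i
      to-toℕ i = Fin.toℕ-injective (≡.trans (Fin.toℕ-fromℕ< _)
        (residue-unique (ℤ.n%ℕd<d (+ toℕ i) n) (Fin.toℕ<n i) (≈-sym (≈-% (+ toℕ i)))))

    cyclic : ∀ ω → 1ℤ + ω + ω * ω ≈ 0ℤ → EisensteinGroup n
    cyclic ω ω-root = record
      { G = ℤ/
      ; f = ω *_
      ; f-cong = *-cong (≈-reflexive {ω} ≡.refl)
      ; f-homo = λ a b → ≈-reflexive (ℤ.*-distribˡ-+ ω a b)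
      ; sum-zero = λ a → ≈-trans (≈-reflexive (lemma a ω)) (*-cong ω-root (≈-reflexive ≡.refl))
      ; order = ℤ/-order
      ; torsion = ℤ/-torsion
      }
      where lemma : ∀ a ω → a + ω * a + ω * (ω * a) ≡ (1ℤ + ω + ω * ω) * a
            lemma = solve-∀

-- Products, and extension of scalars to ℤ[ω]

module _ (G H : AbelianGroup 0ℓ 0ℓ) where
  private
    module G = AbelianGroup G
    module H = AbelianGroup H
    G×H = abelianGroup G H

  ×-order : ∀ {m n} → HasOrder G m → HasOrder H n → HasOrder G×H (m ℕ.* n)
  ×-order oG oH = inverse (oG ×-inverse oH) (inverse Pointwise-≡↔≡ (Symmetry.inverse Fin.*↔×))

  ×-multiple : ∀ k a b → multiple G×H k (a , b) ≡ (multiple G k a , multiple H k b)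
  ×-multiple zero    a b = ≡.refl
  ×-multiple (suc k) a b = ≡.cong (λ (x , y) → a G.∙ x , b H.∙ y) (×-multiple k a b)

module _ (G : AbelianGroup 0ℓ 0ℓ) where
  open AbelianGroup G
  open ≈-Reasoning setoid

  multiple-* : ∀ m n a → multiple G n a ≈ ε → multiple G (m ℕ.* n) a ≈ ε
  multiple-* zero    n a na≈0 = refl
  multiple-* (suc m) n a na≈0 = begin
    multiple G (n ℕ.+ m ℕ.* n) a            ≈⟨ Mult.×-homo-+ monoid a n (m ℕ.* n) ⟩
    multiple G n a ∙ multiple G (m ℕ.* n) a ≈⟨ ∙-cong na≈0 (multiple-* m n a na≈0) ⟩
    ε ∙ ε                                   ≈⟨ identityˡ ε ⟩
    ε                                       ∎

_×ᴱ_ : ∀ {m n} → EisensteinGroup m → EisensteinGroup n → EisensteinGroup (m ℕ.* n)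
_×ᴱ_ {m} {n} E F = record
  { G = abelianGroup E.G F.G
  ; f = λ (a , b) → E.f a , F.f b
  ; f-cong = λ (p , q) → E.f-cong p , F.f-cong q
  ; f-homo = λ (a , b) (c , d) → E.f-homo a c , F.f-homo b d
  ; sum-zero = λ (a , b) → E.sum-zero a , F.sum-zero b
  ; order = ×-order E.G F.G E.order F.order
  ; torsion = λ (a , b) →
      ≡.subst (λ x → AbelianGroup._≈_ (abelianGroup E.G F.G) x (E.0# , F.0#))
        (≡.sym (×-multiple E.G F.G (m ℕ.* n) a b))
        ( E.trans (E.reflexive (≡.cong (λ k → multiple E.G k a) (ℕ.*-comm m n)))
            (multiple-* E.G n m a (E.torsion a))
        , multiple-* F.G m n b (F.torsion b))
  }
  where
  module E = EisensteinGroup E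
  module F = EisensteinGroup F

module _ (G : AbelianGroup 0ℓ 0ℓ) where
  open AbelianGroup G
    renaming (_∙_ to infixl 6 _+_; ε to 0#; _⁻¹ to infix 8 -_
             ; ∙-cong to +-cong; ∙-congˡ to +-congˡ; ⁻¹-cong to -‿cong)
  open import Algebra.Properties.AbelianGroup G
  open import Algebra.Properties.CommutativeSemigroup commutativeSemigroup using (interchange)
  open ≈-Reasoning setoid

  -- G ⊗ ℤ[ω], where ω (x + ω y) = - y + ω (x - y).
  square : ∀ {n} → HasOrder G n → (∀ a → multiple G n a ≈ 0#) → EisensteinGroup (n ℕ.* n)
  square {n} order torsion = record
    { G = abelianGroup G G
    ; f = λ (x , y) → - y , x - y
    ; f-cong = λ (p , q) → -‿cong q , +-cong p (-‿cong q)
    ; f-homo = λ (x , y) (z , w) →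
        sym (⁻¹-∙-comm y w) ,
        trans (+-congˡ (sym (⁻¹-∙-comm y w))) (interchange x z (- y) (- w))
    ; sum-zero = λ (x , y) →
        (begin
          x - y - (x - y)         ≈⟨ inverseʳ (x - y) ⟩
          0#                      ∎) ,
        (begin
          y + (x - y) + (- y - (x - y)) ≈⟨ +-congˡ (⁻¹-∙-comm y (x - y)) ⟩
          y + (x - y) - (y + (x - y))   ≈⟨ inverseʳ (y + (x - y)) ⟩
          0#                            ∎)
    ; order = ×-order G G order order
    ; torsion = λ (a , b) →
        ≡.subst (λ x → AbelianGroup._≈_ (abelianGroup G G) x (0# , 0#))
          (≡.sym (×-multiple G G (n ℕ.* n) a b))
          (multiple-* G n n a (torsion a) , multiple-* G n n b (torsion b))
    }

-- Modulo 1 even ω = 0 is a root: 1 + 0 + 0 evaluates to the modulus itself.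
trivial : EisensteinGroup 1
trivial = cyclic 0ℤ n≈0
  where open Modular 1

-- Counting the 3-cycles of a permutation

-- The inequalities are weak for the sake of the transposition (0 m): the triple starting at 0 reads
-- 0, m, 0, and its first entry must count as least despite the tie.
[min] : ℕ → ℕ → ℕ → ℕ
[min] a b c = if does (a ℕ.≤? b ×-dec a ℕ.≤? c) then 1 else 0

[min]≡1 : ∀ {a b c} → a ℕ.< b → a ℕ.< c → [min] a b c ≡ 1
[min]≡1 a<b a<c = ≡.cong (if_then 1 else 0)
  (dec-true (_ ℕ.≤? _ ×-dec _ ℕ.≤? _) (ℕ.<⇒≤ a<b , ℕ.<⇒≤ a<c))

[min]≡0ˡ : ∀ a b c → b ℕ.< a → [min] a b c ≡ 0
[min]≡0ˡ a b c b<a = ≡.cong (if_then 1 else 0)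
  (dec-false (a ℕ.≤? b ×-dec a ℕ.≤? c) (λ (a≤b , _) → ℕ.<⇒≱ b<a a≤b))

[min]≡0ʳ : ∀ a b c → c ℕ.< a → [min] a b c ≡ 0
[min]≡0ʳ a b c c<a = ≡.cong (if_then 1 else 0)
  (dec-false (a ℕ.≤? b ×-dec a ℕ.≤? c) (λ (_ , a≤c) → ℕ.<⇒≱ c<a a≤c))

unique-min : ∀ a b c → a ≢ b → b ≢ c → c ≢ a →
             [min] a b c ℕ.+ [min] b c a ℕ.+ [min] c a b ≡ 1
unique-min a b c a≢b b≢c c≢a with ℕ.<-cmp a b | ℕ.<-cmp b c | ℕ.<-cmp c a
... | tri≈ _ a≡b _ | _ | _ = contradiction a≡b a≢b
... | _ | tri≈ _ b≡c _ | _ = contradiction b≡c b≢c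
... | _ | _ | tri≈ _ c≡a _ = contradiction c≡a c≢a
... | tri< a<b _ _ | _ | tri> _ _ a<c =
  ≡.cong₂ ℕ._+_ (≡.cong₂ ℕ._+_ ([min]≡1 a<b a<c) ([min]≡0ʳ b c a a<b)) ([min]≡0ˡ c a b a<c)
... | tri> _ _ b<a | tri< b<c _ _ | _ =
  ≡.cong₂ ℕ._+_ (≡.cong₂ ℕ._+_ ([min]≡0ˡ a b c b<a) ([min]≡1 b<c b<a)) ([min]≡0ʳ c a b b<c)
... | _ | tri> _ _ c<b | tri< c<a _ _ =
  ≡.cong₂ ℕ._+_ (≡.cong₂ ℕ._+_ ([min]≡0ʳ a b c c<a) ([min]≡0ˡ b c a c<b)) ([min]≡1 c<a c<b)
... | tri< a<b _ _ | tri< b<c _ _ | tri< c<a _ _ =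
  contradiction (ℕ.<-trans a<b b<c) (ℕ.<-asym c<a)
... | tri> _ _ b<a | tri> _ _ c<b | tri> _ _ a<c =
  contradiction (ℕ.<-trans a<c c<b) (ℕ.<-asym b<a)

open Sum ℕ.+-0-commutativeMonoid using (sum; sum-cong-≗; sum-permute; ∑-distrib-+)

sum-1 : ∀ n → sum {n} (λ _ → 1) ≡ n
sum-1 zero    = ≡.refl
sum-1 (suc n) = ≡.cong suc (sum-1 n)

-- The shape that x ↦ -1/(1+x) would have on ℤ/p, with p = n + 1 and m the class of -1, if 1 + x +
-- x² had no root.
module _ {n} (π : Permutation′ (suc n)) (m : Fin (suc n)) (m≢0 : m ≢ zero)
         (π0≡m : π ⟨$⟩ʳ zero ≡ m) (πm≡0 : π ⟨$⟩ʳ m ≡ zero)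
         (3-cycle : ∀ i → i ≢ zero → i ≢ m →
           π ⟨$⟩ʳ i ≢ i × π ⟨$⟩ʳ (π ⟨$⟩ʳ (π ⟨$⟩ʳ i)) ≡ i) where
  private
    ϕ : Fin (suc n) → Fin (suc n)
    ϕ = π ⟨$⟩ʳ_

    w : Fin (suc n) → ℕ
    w i = [min] (toℕ i) (toℕ (ϕ i)) (toℕ (ϕ (ϕ i)))

    -- Since ϕ is a bijection, each of the three terms sums to Σ w over all i. The total is thus a
    -- multiple of 3 whatever the cycle lengths.
    orbitWeight : Fin (suc n) → ℕ
    orbitWeight i = w i ℕ.+ w (ϕ i) ℕ.+ w (ϕ (ϕ i))

  [min]-m≡0 : [min] (toℕ m) 0 (toℕ m) ≡ 0
  [min]-m≡0 = [min]≡0ˡ (toℕ m) 0 (toℕ m) (ℕ.n≢0⇒n>0 (λ m≡0 → m≢0 (Fin.toℕ-injective m≡0)))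

  -- The walk 0, m, 0 meets the least point of its cycle twice, whereas m, 0, m meets it once. The
  -- extra unit stands in for ∞, so the total 2 + n is the number p + 1 of points of the projective
  -- line.
  orbitWeight-zero : orbitWeight zero ≡ 2
  orbitWeight-zero rewrite π0≡m | πm≡0 | π0≡m | [min]-m≡0 = ≡.refl

  orbitWeight-nonzero : ∀ i → i ≢ zero → orbitWeight i ≡ 1
  orbitWeight-nonzero i i≢0 with i Fin.≟ m
  ... | yes ≡.refl rewrite πm≡0 | π0≡m | πm≡0 | π0≡m | [min]-m≡0 = ≡.refl
  ... | no i≢m with 3-cycle i i≢0 i≢m
  ...   | ϕi≢i , ϕ³i≡i rewrite ϕ³i≡i = unique-min _ _ _
    (λ eq → ϕi≢i (≡.sym (Fin.toℕ-injective eq)))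
    (λ eq → let ϕi≡ϕϕi = Fin.toℕ-injective eq in
      ϕi≢i (≡.trans ϕi≡ϕϕi (≡.trans (≡.cong ϕ ϕi≡ϕϕi) ϕ³i≡i)))
    (λ eq → ϕi≢i (≡.trans (≡.cong ϕ (≡.sym (Fin.toℕ-injective eq))) ϕ³i≡i))

  -- Each i ∉ {0, m} lies in a 3-cycle with exactly one least element, so
  -- 3 Σ w counts every point once, except for an excess of 1 from (0 m).
  3∣2+n : 3 ℕ.∣ 2 ℕ.+ n
  3∣2+n = ℕ.divides (sum w) (begin
    2 ℕ.+ n
      ≡⟨ ≡.cong (2 ℕ.+_) (sum-1 n) ⟨
    2 ℕ.+ sum {n} (λ _ → 1)
      ≡⟨ ≡.cong₂ ℕ._+_ orbitWeight-zero (sum-cong-≗ λ i → orbitWeight-nonzero (suc i) λ ()) ⟨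
    sum orbitWeight
      ≡⟨ ∑-distrib-+ (λ i → w i ℕ.+ w (ϕ i)) (λ i → w (ϕ (ϕ i))) ⟩
    sum (λ i → w i ℕ.+ w (ϕ i)) ℕ.+ sum (λ i → w (ϕ (ϕ i)))
      ≡⟨ ≡.cong₂ ℕ._+_ (∑-distrib-+ w (λ i → w (ϕ i))) (≡.sym (sum-permute (λ i → w (ϕ i)) π)) ⟩
    sum w ℕ.+ sum (λ i → w (ϕ i)) ℕ.+ sum (λ i → w (ϕ i))
      ≡⟨ ≡.cong (λ s → sum w ℕ.+ s ℕ.+ s) (≡.sym (sum-permute w π)) ⟩
    sum w ℕ.+ sum w ℕ.+ sum w
      ≡⟨ lemma (sum w) ⟩
    sum w ℕ.* 3
      ∎)
    where
    open ≡.≡-Reasoning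
    lemma : ∀ s → s ℕ.+ s ℕ.+ s ≡ s ℕ.* 3
    lemma = ℕ.solve-∀

-- A root of 1 + x + x² modulo a prime p ≡ 1 (mod 6)

module Möbius (n : ℕ) (p-prime : Prime (suc n)) where
  open import Data.Integer.Base using (_+_; _*_; -_; _-_)

  p : ℕ
  p = suc n
  open Modular p
  open ≈-Reasoning setoid

  ≈-refl : ∀ {a} → a ≈ a
  ≈-refl = ≈-reflexive ≡.refl

  open Inverse ℤ/-order using (to; from; to-cong)
    renaming (strictlyInverseˡ to to-from; strictlyInverseʳ to from-to)

  to-injective : ∀ {a b} → to a ≡ to b → a ≈ b
  to-injective {a} {b} eq = ≈-trans (≈-sym (from-to a))
    (≈-trans (≈-reflexive (≡.cong from eq)) (from-to b))

  1<p : 1 ℕ.< p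
  1<p = ℕ.nonTrivial⇒n>1 p {{prime⇒nonTrivial p-prime}}

  1≉0 : ¬ (1ℤ ≈ 0ℤ)
  1≉0 1≈0 = contradiction (residue-unique 1<p (s≤s z≤n) 1≈0) λ ()

  -- The residue r of x is positive and below the prime p, hence coprime to it. Over ℕ the Bézout
  -- identity has two forms, according to which side is larger; they give the inverses -v and v.
  unit : ∀ x → ¬ (x ≈ 0ℤ) → ∃ λ y → x * y ≈ 1ℤ
  unit x x≉0 with x %ℕ p in eq | ≈-% x | ℤ.n%ℕd<d x p
  ... | zero  | x≈0 | _ = contradiction x≈0 x≉0
  ... | r@(suc _) | x≈r | r<p with coprime-Bézout (prime⇒coprime p-prime r<p)
  ...   | Bézout.+- u v 1+vr≡up = - + v , (begin
    x * - + v                 ≈⟨ *-cong x≈r ≈-refl ⟩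
    + r * - + v               ≡⟨ lemma (+ r) (+ v) ⟩
    1ℤ - (1ℤ + + v * + r)     ≡⟨ ≡.cong (λ t → 1ℤ - (1ℤ + t)) (ℤ.pos-* v r) ⟨
    1ℤ - + (1 ℕ.+ v ℕ.* r)    ≡⟨ ≡.cong (λ t → 1ℤ - + t) 1+vr≡up ⟩
    1ℤ - + (u ℕ.* p)          ≡⟨ ≡.cong (λ t → 1ℤ - t) (ℤ.pos-* u p) ⟩
    1ℤ - + u * + p            ≈⟨ +-cong (≈-refl {1ℤ}) (-‿cong (*-cong (≈-refl {+ u}) n≈0)) ⟩
    1ℤ - + u * 0ℤ             ≡⟨ ≡.cong (λ t → 1ℤ - t) (ℤ.*-zeroʳ (+ u)) ⟩
    1ℤ                        ∎)
    where lemma : ∀ r v → r * - v ≡ 1ℤ - (1ℤ + v * r)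
          lemma = solve-∀
  ...   | Bézout.-+ u v 1+up≡vr = + v , (begin
    x * + v                 ≈⟨ *-cong x≈r ≈-refl ⟩
    + r * + v               ≡⟨ ℤ.*-comm (+ r) (+ v) ⟩
    + v * + r               ≡⟨ ℤ.pos-* v r ⟨
    + (v ℕ.* r)             ≡⟨ ≡.cong +_ 1+up≡vr ⟨
    1ℤ + + (u ℕ.* p)        ≡⟨ ≡.cong (λ t → 1ℤ + t) (ℤ.pos-* u p) ⟩
    1ℤ + + u * + p          ≈⟨ +-cong (≈-refl {1ℤ}) (*-cong (≈-refl {+ u}) n≈0) ⟩
    1ℤ + + u * 0ℤ           ≡⟨ ≡.cong (λ t → 1ℤ + t) (ℤ.*-zeroʳ (+ u)) ⟩
    1ℤ                      ∎)

  -- Inversion, extended by 0 ↦ 0 so that it is a total involution.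
  Inv : ℤ → ℤ → Set
  Inv x y = (x ≈ 0ℤ × y ≈ 0ℤ) ⊎ x * y ≈ 1ℤ

  Inv-sym : ∀ {x y} → Inv x y → Inv y x
  Inv-sym (inj₁ (x≈0 , y≈0)) = inj₁ (y≈0 , x≈0)
  Inv-sym {x} {y} (inj₂ xy≈1) = inj₂ (≈-trans (≈-reflexive (ℤ.*-comm y x)) xy≈1)

  0∤1 : ∀ {x y} → x ≈ 0ℤ → ¬ (x * y ≈ 1ℤ)
  0∤1 x≈0 xy≈1 = 1≉0 (≈-trans (≈-sym xy≈1) (*-cong x≈0 ≈-refl))

  -- Uniqueness of inverses in this form yields at once that `inv` respects congruence, that it is
  -- an involution, and what its values at given arguments are.
  Inv-functional : ∀ {x x′ y y′} → x ≈ x′ → Inv x y → Inv x′ y′ → y ≈ y′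
  Inv-functional x≈x′ (inj₁ (_ , y≈0)) (inj₁ (_ , y′≈0)) = ≈-trans y≈0 (≈-sym y′≈0)
  Inv-functional x≈x′ (inj₁ (x≈0 , _)) (inj₂ x′y′≈1) =
    contradiction x′y′≈1 (0∤1 (≈-trans (≈-sym x≈x′) x≈0))
  Inv-functional x≈x′ (inj₂ xy≈1) (inj₁ (x′≈0 , _)) =
    contradiction xy≈1 (0∤1 (≈-trans x≈x′ x′≈0))
  Inv-functional {x} {x′} {y} {y′} x≈x′ (inj₂ xy≈1) (inj₂ x′y′≈1) = begin
    y             ≡⟨ ℤ.*-identityʳ y ⟨
    y * 1ℤ        ≈⟨ *-cong (≈-refl {y}) x′y′≈1 ⟨
    y * (x′ * y′) ≈⟨ *-cong (≈-refl {y}) (*-cong x≈x′ (≈-refl {y′})) ⟨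
    y * (x * y′)  ≡⟨ lemma x y y′ ⟩
    x * y * y′    ≈⟨ *-cong xy≈1 ≈-refl ⟩
    1ℤ * y′       ≡⟨ ℤ.*-identityˡ y′ ⟩
    y′            ∎
    where lemma : ∀ x y z → y * (x * z) ≡ x * y * z
          lemma = solve-∀

  Inv-total : ∀ x → ∃ (Inv x)
  Inv-total x with to x Fin.≟ to 0ℤ
  ... | yes eq = 0ℤ , inj₁ (to-injective eq , ≈-refl)
  ... | no neq = let y , xy≈1 = unit x (λ x≈0 → neq (to-cong x≈0)) in y , inj₂ xy≈1

  inv : ℤ → ℤ
  inv x = proj₁ (Inv-total x)

  Inv-inv : ∀ x → Inv x (inv x)
  Inv-inv x = proj₂ (Inv-total x)

  inv-cong : ∀ {x y} → x ≈ y → inv x ≈ inv y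
  inv-cong {x} {y} x≈y = Inv-functional x≈y (Inv-inv x) (Inv-inv y)

  inv-involutive : ∀ x → inv (inv x) ≈ x
  inv-involutive x = Inv-functional ≈-refl (Inv-inv (inv x)) (Inv-sym (Inv-inv x))

  -- This is x ↦ -1/(1+x), whose cycle through ∞ is 0, -1, ∞. The convention that `inv` sends 0 to 0
  -- maps -1 directly to 0, skipping ∞ and keeping the map a bijection of ℤ/p.
  möbius : ℤ → ℤ
  möbius x = - inv (1ℤ + x)

  möbius-cong : ∀ {x y} → x ≈ y → möbius x ≈ möbius y
  möbius-cong x≈y = -‿cong (inv-cong (+-cong (≈-refl {1ℤ}) x≈y))

  möbius-inverse : Inverse setoid setoid
  möbius-inverse = record
    { to = möbius
    ; from = möbius⁻¹
    ; to-cong = möbius-cong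
    ; from-cong = möbius⁻¹-cong
    ; inverse = (λ {y} x≈ → ≈-trans (möbius-cong x≈) (möbius-möbius⁻¹ y))
              , (λ {x} y≈ → ≈-trans (möbius⁻¹-cong y≈) (möbius⁻¹-möbius x))
    }
    where
    möbius⁻¹ : ℤ → ℤ
    möbius⁻¹ y = inv (- y) - 1ℤ
    möbius⁻¹-cong : ∀ {x y} → x ≈ y → möbius⁻¹ x ≈ möbius⁻¹ y
    möbius⁻¹-cong x≈y = +-cong (inv-cong (-‿cong x≈y)) ≈-refl
    1+[a-1]≡a : ∀ a → 1ℤ + (a - 1ℤ) ≡ a
    1+[a-1]≡a = solve-∀
    1+a-1≡a : ∀ a → 1ℤ + a - 1ℤ ≡ a
    1+a-1≡a = solve-∀
    möbius-möbius⁻¹ : ∀ y → möbius (möbius⁻¹ y) ≈ y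
    möbius-möbius⁻¹ y = begin
      - inv (1ℤ + (inv (- y) - 1ℤ)) ≡⟨ ≡.cong (λ t → - inv t) (1+[a-1]≡a (inv (- y))) ⟩
      - inv (inv (- y))             ≈⟨ -‿cong (inv-involutive (- y)) ⟩
      - - y                         ≡⟨ ℤ.neg-involutive y ⟩
      y                             ∎
    möbius⁻¹-möbius : ∀ x → möbius⁻¹ (möbius x) ≈ x
    möbius⁻¹-möbius x = begin
      inv (- - inv (1ℤ + x)) - 1ℤ   ≡⟨ ≡.cong (λ t → inv t - 1ℤ) (ℤ.neg-involutive (inv (1ℤ + x))) ⟩
      inv (inv (1ℤ + x)) - 1ℤ       ≈⟨ +-cong (inv-involutive (1ℤ + x)) ≈-refl ⟩
      1ℤ + x - 1ℤ                   ≡⟨ 1+a-1≡a x ⟩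
      x                             ∎

  möbius-unique : ∀ x y → (1ℤ + x) * y ≈ -1ℤ → möbius x ≈ y
  möbius-unique x y eq = ≈-trans
    (-‿cong (Inv-functional ≈-refl (Inv-inv (1ℤ + x))
      (inj₂ (≈-trans (≈-reflexive (lemma x y)) (-‿cong eq)))))
    (≈-reflexive (ℤ.neg-involutive y))
    where lemma : ∀ x y → (1ℤ + x) * - y ≡ - ((1ℤ + x) * y)
          lemma = solve-∀

  möbius-equation : ∀ x → ¬ (x ≈ -1ℤ) → (1ℤ + x) * möbius x ≈ -1ℤ
  möbius-equation x x≉-1 with Inv-inv (1ℤ + x)
  ... | inj₁ (1+x≈0 , _) = contradiction
    (≈-trans (≈-reflexive (lemma x)) (+-cong 1+x≈0 (≈-refl { -1ℤ}))) x≉-1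
    where lemma : ∀ x → x ≡ 1ℤ + x + -1ℤ
          lemma = solve-∀
  ... | inj₂ eq = ≈-trans
    (≈-reflexive (≡.sym (ℤ.neg-distribʳ-* (1ℤ + x) (inv (1ℤ + x))))) (-‿cong eq)

  möbius³ : ∀ x → ¬ (x ≈ 0ℤ) → ¬ (x ≈ -1ℤ) → möbius (möbius (möbius x)) ≈ x
  möbius³ x x≉0 x≉-1 with unit x x≉0
  ... | u , xu≈1 = begin
    möbius (möbius y) ≈⟨ möbius-cong (möbius-unique y z [1+y]z≈-1) ⟩
    möbius z          ≈⟨ möbius-unique z x [1+z]x≈-1 ⟩
    x                 ∎
    where
    y = möbius x
    -- The second iterate: 1 + y = x/(1+x), so -1/(1+y) = -(1+x)/x, with u in the role of 1/x.
    z = - ((1ℤ + x) * u)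
    lemma₁ : ∀ x y u → (1ℤ + y) * - ((1ℤ + x) * u) ≡ - ((1ℤ + x + (1ℤ + x) * y) * u)
    lemma₁ = solve-∀
    lemma₂ : ∀ x u → - ((1ℤ + x + -1ℤ) * u) ≡ - (x * u)
    lemma₂ = solve-∀
    lemma₃ : ∀ x u → (1ℤ + - ((1ℤ + x) * u)) * x ≡ x - (1ℤ + x) * (x * u)
    lemma₃ = solve-∀
    lemma₄ : ∀ x → x - (1ℤ + x) * 1ℤ ≡ -1ℤ
    lemma₄ = solve-∀
    [1+y]z≈-1 : (1ℤ + y) * z ≈ -1ℤ
    [1+y]z≈-1 = begin
      (1ℤ + y) * z
        ≡⟨ lemma₁ x y u ⟩
      - ((1ℤ + x + (1ℤ + x) * y) * u)
        ≈⟨ -‿cong (*-cong (+-cong (≈-refl {1ℤ + x}) (möbius-equation x x≉-1)) (≈-refl {u})) ⟩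
      - ((1ℤ + x + -1ℤ) * u)
        ≡⟨ lemma₂ x u ⟩
      - (x * u)
        ≈⟨ -‿cong xu≈1 ⟩
      -1ℤ
        ∎
    [1+z]x≈-1 : (1ℤ + z) * x ≈ -1ℤ
    [1+z]x≈-1 = begin
      (1ℤ + z) * x           ≡⟨ lemma₃ x u ⟩
      x - (1ℤ + x) * (x * u) ≈⟨ +-cong (≈-refl {x}) (-‿cong (*-cong (≈-refl {1ℤ + x}) xu≈1)) ⟩
      x - (1ℤ + x) * 1ℤ      ≡⟨ lemma₄ x ⟩
      -1ℤ                    ∎

  möbius-0 : möbius 0ℤ ≈ -1ℤ
  möbius-0 = möbius-unique 0ℤ -1ℤ ≈-refl

  möbius--1 : möbius -1ℤ ≈ 0ℤ
  möbius--1 = -‿cong (Inv-functional ≈-refl (Inv-inv 0ℤ) (inj₁ (≈-refl , ≈-refl)))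

  fixed⇒root : ∀ x → ¬ (x ≈ -1ℤ) → möbius x ≈ x → 1ℤ + x + x * x ≈ 0ℤ
  fixed⇒root x x≉-1 fixed = begin
    1ℤ + x + x * x            ≡⟨ lemma x ⟩
    1ℤ + (1ℤ + x) * x         ≈⟨ +-cong (≈-refl {1ℤ}) (*-cong (≈-refl {1ℤ + x}) fixed) ⟨
    1ℤ + (1ℤ + x) * möbius x  ≈⟨ +-cong (≈-refl {1ℤ}) (möbius-equation x x≉-1) ⟩
    0ℤ                        ∎
    where lemma : ∀ x → 1ℤ + x + x * x ≡ 1ℤ + (1ℤ + x) * x
          lemma = solve-∀

  π : Permutation′ p
  π = inverse (Symmetry.inverse ℤ/-order) (inverse möbius-inverse ℤ/-order)

  π-to : ∀ x → π ⟨$⟩ʳ to x ≡ to (möbius x)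
  π-to x = to-cong (möbius-cong (from-to x))

  -- x ↦ -1/(1+x) has order 3 on ℤ/p ∖ {0, -1}, and its fixed points there are the roots.
  root : p % 6 ≡ 1 → ∃ λ ω → 1ℤ + ω + ω * ω ≈ 0ℤ
  root p≡1 with Fin.any? (λ i → to (1ℤ + from i + from i * from i) Fin.≟ to 0ℤ)
  ... | yes (i , eq) = from i , to-injective eq
  ... | no rootless = contradiction 3∣2 λ { (ℕ.divides (suc _) ()) }
    where
    to0≡zero : to 0ℤ ≡ zero
    to0≡zero = Fin.toℕ-injective (Fin.toℕ-fromℕ< (ℤ.n%ℕd<d 0ℤ p))
    ≉ : ∀ i {a j} → to a ≡ j → i ≢ j → ¬ (from i ≈ a)
    ≉ i eq i≢j i≈a = i≢j (≡.trans (≡.sym (to-from i)) (≡.trans (to-cong i≈a) eq))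
    3-cycle : ∀ i → i ≢ zero → i ≢ to -1ℤ → π ⟨$⟩ʳ i ≢ i × π ⟨$⟩ʳ (π ⟨$⟩ʳ (π ⟨$⟩ʳ i)) ≡ i
    3-cycle i i≢0 i≢-1 =
      (λ πi≡i → rootless (i , to-cong (fixed⇒root (from i) i≉-1
        (to-injective (≡.trans πi≡i (≡.sym (to-from i))))))) ,
      ≡.trans (≡.cong (π ⟨$⟩ʳ_) (π-to (möbius (from i)))) (≡.trans (π-to (möbius (möbius (from i))))
        (≡.trans (to-cong (möbius³ (from i) (≉ i to0≡zero i≢0) i≉-1)) (to-from i)))
      where i≉-1 = ≉ i ≡.refl i≢-1
    -1≢0 : to -1ℤ ≢ zero
    -1≢0 eq = 1≉0 (-‿cong (to-injective { -1ℤ} {0ℤ} (≡.trans eq (≡.sym to0≡zero))))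
    π0≡-1 : π ⟨$⟩ʳ zero ≡ to -1ℤ
    π0≡-1 = ≡.trans (≡.cong (π ⟨$⟩ʳ_) (≡.sym to0≡zero)) (≡.trans (π-to 0ℤ) (to-cong möbius-0))
    π-1≡0 : π ⟨$⟩ʳ to -1ℤ ≡ zero
    π-1≡0 = ≡.trans (π-to -1ℤ) (≡.trans (to-cong möbius--1) to0≡zero)
    3∣n : 3 ℕ.∣ n
    3∣n = ℕ.∣-trans (ℕ.divides 2 ≡.refl) (ℕ.divides (p / 6) (ℕ.suc-injective
      (≡.trans (ℕ.m≡m%n+[m/n]*n p 6) (≡.cong (ℕ._+ p / 6 ℕ.* 6) p≡1))))
    -- The count gives 3 ∣ n + 2, while p = n + 1 ≡ 1 (mod 6) gives 3 ∣ n.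
    3∣2 : 3 ℕ.∣ 2
    3∣2 = ℕ.∣m+n∣m⇒∣n
      (≡.subst (3 ℕ.∣_) (ℕ.+-comm 2 n) (3∣2+n π (to -1ℤ) -1≢0 π0≡-1 π-1≡0 3-cycle)) 3∣n

  field-group : p % 6 ≡ 1 → EisensteinGroup p
  field-group p≡1 = let ω , eq = root p≡1 in cyclic ω eq

-- Prime powers and their products

prime-group : ∀ {p} → Prime p → p % 6 ≡ 1 → EisensteinGroup p
prime-group {suc n} p-prime = Möbius.field-group n p-prime

-- The group underlying a CO(q) may be any abelian group of order q, so powers of ℤ/p serve in place
-- of ℤ/p^k, and no root is lifted modulo p^k.
_^ᴱ_ : ∀ {n} → EisensteinGroup n → ∀ k → EisensteinGroup (n ^ k)
E ^ᴱ zero  = trivial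
E ^ᴱ suc k = E ×ᴱ (E ^ᴱ k)

square-group : ∀ n .{{_ : NonZero n}} → EisensteinGroup (n ℕ.* n)
square-group n = square ℤ/ ℤ/-order ℤ/-torsion
  where open Modular n

-- A factor of a unit modulo 6 is a unit, and the units are 1 and 5; all pairs of residues are
-- checked by computation. Applied to q = p · p^k, this excludes p = 2 and p = 3.
unit-mod-6 : ∀ a b → (a ℕ.* b) % 6 ≡ 1 → a % 6 ≡ 1 ⊎ a % 6 ≡ 5
unit-mod-6 a b ab≡1 = ≡.subst (λ r → r ≡ 1 ⊎ r ≡ 5) (Fin.toℕ-fromℕ< a<6)
  (toWitness {a? = Fin.all? λ r → Fin.all? λ s →
     ((toℕ r ℕ.* toℕ s) % 6 ℕ.≟ 1) →-dec (toℕ r ℕ.≟ 1 ⊎-dec toℕ r ℕ.≟ 5)} _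
     (fromℕ< a<6) (fromℕ< b<6)
     (≡.trans (≡.cong₂ (λ r s → (r ℕ.* s) % 6) (Fin.toℕ-fromℕ< a<6) (Fin.toℕ-fromℕ< b<6))
       (≡.trans (≡.sym (ℕ.%-distribˡ-* a b 6)) ab≡1)))
  where
  a<6 = ℕ.m%n<n a 6
  b<6 = ℕ.m%n<n b 6

-- As p² ≡ 1 (mod 6), lowering the exponent by two keeps the residue. The descent cannot stop at
-- exponent 1, where the residue would be 5, so it reaches 0.
even-power : ∀ p .{{_ : NonZero p}} → p % 6 ≡ 5 → ∀ k → (p ^ k) % 6 ≡ 1 →
             EisensteinGroup (p ^ k)
even-power p p≡5 zero          _  = trivial
even-power p p≡5 (suc zero)    eq = contradiction
  (≡.trans (≡.sym p≡5) (≡.trans (≡.cong (_% 6) (≡.sym (ℕ.*-identityʳ p))) eq)) λ ()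
even-power p p≡5 (suc (suc k)) eq = ≡.subst EisensteinGroup (ℕ.*-assoc p p (p ^ k))
  (square-group p ×ᴱ even-power p p≡5 k (≡.trans (≡.sym p^2+k≡p^k) eq))
  where
  open ≡.≡-Reasoning
  p*p≡1 : (p ℕ.* p) % 6 ≡ 1
  p*p≡1 = ≡.trans (ℕ.%-distribˡ-* p p 6) (≡.cong (λ r → (r ℕ.* r) % 6) p≡5)
  p^2+k≡p^k : (p ^ (2 ℕ.+ k)) % 6 ≡ (p ^ k) % 6
  p^2+k≡p^k = begin
    (p ℕ.* (p ℕ.* p ^ k)) % 6             ≡⟨ ≡.cong (_% 6) (ℕ.*-assoc p p (p ^ k)) ⟨
    (p ℕ.* p ℕ.* p ^ k) % 6               ≡⟨ ℕ.%-distribˡ-* (p ℕ.* p) (p ^ k) 6 ⟩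
    ((p ℕ.* p) % 6 ℕ.* ((p ^ k) % 6)) % 6 ≡⟨ ≡.cong (λ r → (r ℕ.* ((p ^ k) % 6)) % 6) p*p≡1 ⟩
    (1 ℕ.* ((p ^ k) % 6)) % 6             ≡⟨ ≡.cong (_% 6) (ℕ.*-identityˡ ((p ^ k) % 6)) ⟩
    (p ^ k) % 6 % 6                       ≡⟨ ℕ.m%n%n≡m%n (p ^ k) 6 ⟩
    (p ^ k) % 6                           ∎

prime-power-group : ∀ {q} → IsPrimePower q → q % 6 ≡ 1 → EisensteinGroup q
prime-power-group (p , suc k , p-prime , _ , ≡.refl) q≡1 with unit-mod-6 p (p ^ k) q≡1
... | inj₁ p≡1 = prime-group p-prime p≡1 ^ᴱ suc k
... | inj₂ p≡5 = even-power p {{prime⇒nonZero p-prime}} p≡5 (suc k) q≡1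

product-group : ∀ {qs} → All (λ qᵢ → IsPrimePower qᵢ × qᵢ % 6 ≡ 1) qs →
                EisensteinGroup (product qs)
product-group []                 = trivial
product-group ((pp , q≡1) ∷ pqs) = prime-power-group pp q≡1 ×ᴱ product-group pqs

product≡1[6] : ∀ {qs} → All (λ qᵢ → IsPrimePower qᵢ × qᵢ % 6 ≡ 1) qs → product qs % 6 ≡ 1
product≡1[6] [] = ≡.refl
product≡1[6] {q ∷ qs} ((_ , q≡1) ∷ pqs) = ≡.trans (ℕ.%-distribˡ-* q (product qs) 6)
  (≡.cong₂ (λ r s → (r ℕ.* s) % 6) q≡1 (product≡1[6] pqs))

corollary2p3 : ∀ (qs : List ℕ) →
    All (λ qᵢ → IsPrimePower qᵢ × qᵢ % 6 ≡ 1) qs →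
    CO (product qs)
corollary2p3 qs pqs = cubicOrthomorphism (product-group pqs) (product≡1[6] pqs)
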